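{- Let $p$ be a prime and let $A,B\subset GF(p)$ be sets with $|A|\ge 2$, $|B|\ge 2$ and $|A||B|<p$. Then the set of points $A\times B\subset AG(2,p)$ determines at least $|A||B|-\min\{|A|,|B|\}+2$ directions.
   Context: $AG(2,p)$ is the affine plane over $GF(p)$, with points $(a,b)$, $a,b\in GF(p)$. For a set $U=\{(a_i,b_i)\}\subset AG(2,p)$, the set of directions determined by $U$ is $D=\left\{\frac{b_i-b_j}{a_i-a_j} : (a_i,b_i)\neq(a_j,b_j)\in U\right\}\subseteq GF(p)\cup\{\infty\}$, where the quotient is $\infty$ when $a_i=a_j$; equivalently, a direction is determined by $U$ if some line in that direction contains two distinct points of $U$. -}

module Defs where

open import Data.Nat using (ℕ)
open import Data.Fin using (Fin; toℕ)
open import Data.Fin.Subset using (Subset; _∈_)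
open import Data.Integer using (ℤ; +_; _-_; _*_)
open import Data.Integer.Divisibility using (_∣_)
open import Data.Maybe using (Maybe; just; nothing)
open import Data.Product using (_×_; _,_; Σ; ∃)
open import Relation.Binary.PropositionalEquality using (_≡_; _≢_)
open import Level using (0ℓ; suc)

-- Elements of GF(p) are represented by Fin p (residues 0..p-1);
-- field arithmetic is expressed via congruences mod p in ℤ.
GF : ℕ → Set
GF p = Fin p

ι : {p : ℕ} → GF p → ℤ
ι x = + toℕ x

_≡[mod_]_ : ℤ → ℕ → ℤ → Set
x ≡[mod p ] y = (+ p) ∣ (x - y)

Point : ℕ → Set
Point p = GF p × GF p

-- Directions: GF(p) ∪ {∞}, with nothing = ∞
Direction : ℕ → Set
Direction p = Maybe (GF p)

_⊠_ : {p : ℕ} → Subset p → Subset p → Point p → Set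
(A ⊠ B) (a , b) = (a ∈ A) × (b ∈ B)

Determines : {p : ℕ} → (Point p → Set) → Direction p → Set
Determines {p} U (just d) =
  Σ (Point p) λ u → Σ (Point p) λ v → U u × U v × u ≢ v ×
    (let (a₁ , b₁) = u ; (a₂ , b₂) = v in
     (ι b₁ - ι b₂) ≡[mod p ] (ι d * (ι a₁ - ι a₂)))
Determines {p} U nothing =
  Σ (Point p) λ u → Σ (Point p) λ v → U u × U v × u ≢ v ×
    (let (a₁ , b₁) = u ; (a₂ , b₂) = v in a₁ ≡ a₂)

{-# OPTIONS --safe #-}
-- A direction y of GF(p) is not determined by U = A × B exactly when the intercepts b - a y,
-- (a , b) ∈ U, are distinct.  By Newton interpolation the remainder of X^p modulo the Rédei
-- polynomial ∏ (X - (b - a y)) has Newton coefficients h_{p-j}(t₀ , … , t_j), where h is the complete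
-- homogeneous symmetric polynomial and the tᵢ are intercepts; for undetermined y they are divided
-- differences of x ↦ x^p = x, hence vanish for j ≥ 2.  As a polynomial in y such a coefficient has
-- degree at most p - j, so if at most N directions (with ∞) are determined it is zero for j ≥ N.
-- At y = 0 this gives X^p ≡ r modulo ∏_b (X - b)^|A| with deg r < N.  Taking derivatives,
-- ∏_b (X - b)^(|A|-1) divides r′; if N ≤ |A||B| - |B| + 1, this forces r′ = 0, so r is constant and
-- b = b^p = r for every b ∈ B, contradicting |B| ≥ 2.  Reading off the coefficient of y^(p-j)
-- instead of the value at 0 replaces the nodes b by -a and gives the bound with |A|.
module Submission where

open import Defs
open import Data.Nat as ℕ using (ℕ; zero; suc; z≤n; s≤s; _!)
import Data.Nat.Properties as ℕ
open import Data.Nat.Combinatorics using (_C_; nCn≡1; nCk≡n!/k![n-k]!; k![n∸k]!∣n!)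
import Data.Nat.Divisibility as ℕ
open import Data.Nat.DivMod using (m/n*n≡m)
open import Data.Nat.Primality using (Prime; euclidsLemma; prime⇒nonTrivial)
open import Data.Bool using (true; false)
open import Data.Empty using (⊥)
open import Data.Fin as Fin using (Fin)
import Data.Fin.Properties as Fin
open import Data.Fin.Subset using (Subset; inside; outside)
open import Data.Fin.Subset.Properties using (_∈?_)
open import Data.List using (List; []; _∷_; _++_; length; map; replicate; concatMap; filter; allFin; cartesianProductWith)
open import Data.List.Properties using (length-map; length-++; length-replicate; length-tabulate; map-++)
open import Data.List.Membership.Propositional using (_∈_)
open import Data.List.Membership.Propositional.Properties using (∈-concatMap⁺; ∈-map⁻)
open import Data.List.Relation.Unary.All as All using (All; []; _∷_)
import Data.List.Relation.Unary.All.Properties as All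
open import Data.List.Relation.Unary.AllPairs as AllPairs using (AllPairs; []; _∷_)
import Data.List.Relation.Unary.AllPairs.Properties as AllPairs
open import Data.List.Relation.Unary.Any as Any using (here; there)
open import Data.List.Relation.Unary.Unique.Propositional using (Unique)
import Data.List.Relation.Unary.Unique.Propositional.Properties as Unique
open import Data.Maybe using (just; nothing)
open import Data.Maybe.Properties using (just-injective)
open import Data.Product using (Σ; ∃; _×_; _,_; proj₁; proj₂)
open import Data.Product.Properties using (≡-dec)
open import Data.Sum using (inj₁; inj₂)
open import Data.Unit using (⊤; tt)
open import Data.Vec using ([]; _∷_; here; there)
open import Data.Vec.Functional using (Vector; init; last; tail)
open import Function using (_∘_)
open import Relation.Nullary using (¬_; Dec; yes; no; ¬?; _×-dec_; contradiction)
import Relation.Nullary.Decidable as Dec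
open import Relation.Binary.PropositionalEquality

module _ where
  open import Data.Fin.Subset using () renaming (∣_∣ to ∣_∣ₛ; _∈_ to _∈ₛ_)
  open import Data.Integer using (ℤ; +_; -[1+_]; _+_; _-_; _*_; -_; 0ℤ; 1ℤ; ∣_∣)
  import Data.Integer.Properties as ℤ
  open import Data.Integer.Divisibility.Signed using (_∣_; divides; ∣ᵤ⇒∣; ∣⇒∣ᵤ; ∣m∣n⇒∣m+n; ∣m∣n⇒∣m-n; ∣m⇒∣-m; ∣n⇒∣m*n; ∣m⇒∣m*n; ∣-refl)
  open import Data.Integer.Tactic.RingSolver using (solve-∀)
  open import Algebra.Properties.CommutativeSemiring.Binomial ℤ.+-*-commutativeSemiring using (theorem; binomialTerm)
  open import Algebra.Properties.Semiring.Exp ℤ.+-*-semiring using (_^_)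
  open import Algebra.Properties.Semiring.Mult ℤ.+-*-semiring using () renaming (_×_ to _·_)
  open import Algebra.Properties.Semiring.Sum ℤ.+-*-semiring using (sum; sum-init-last)

  -- Complete homogeneous symmetric polynomials

  -- The complete homogeneous symmetric polynomial of degree m in the entries of L.
  h : ℕ → List ℤ → ℤ
  h zero    L       = 1ℤ
  h (suc m) []      = 0ℤ
  h (suc m) (t ∷ L) = h (suc m) L + t * h m (t ∷ L)

  -- With `h-singleton` as base, this recurrence makes `h m` at k + 1 nodes the k-th divided
  -- difference of x ↦ x^(m + k).
  h-divided-difference : ∀ m x y L →
    (x - y) * h m (x ∷ y ∷ L) ≡ h (suc m) (x ∷ L) - h (suc m) (y ∷ L)
  h-divided-difference zero x y L = lemma x y (h 1 L)
    where
    lemma : ∀ x y c → (x - y) * 1ℤ ≡ (c + x * 1ℤ) - (c + y * 1ℤ)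
    lemma = solve-∀
  h-divided-difference (suc m) x y L = begin
    (x - y) * (u + x * h m (x ∷ y ∷ L))       ≡⟨ expand x y u (h m (x ∷ y ∷ L)) ⟩
    (x - y) * u + x * ((x - y) * h m (x ∷ y ∷ L))
      ≡⟨ cong (λ z → (x - y) * u + x * z) (h-divided-difference m x y L) ⟩
    (x - y) * u + x * (h (suc m) (x ∷ L) - u) ≡⟨ collect x y u (h (suc m) (x ∷ L)) (h (suc (suc m)) L) ⟩
    h (suc (suc m)) (x ∷ L) - h (suc (suc m)) (y ∷ L) ∎
    where
    open ≡-Reasoning
    u = h (suc m) (y ∷ L)
    expand : ∀ x y u v → (x - y) * (u + x * v) ≡ (x - y) * u + x * ((x - y) * v)
    expand = solve-∀
    collect : ∀ x y u v c → (x - y) * u + x * (v - u) ≡ (c + x * v) - (c + y * u)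
    collect = solve-∀

  h-singleton : ∀ m x → h m (x ∷ []) ≡ x ^ m
  h-singleton zero    x = refl
  h-singleton (suc m) x = trans (ℤ.+-identityˡ _) (cong (x *_) (h-singleton m x))

  -- Polynomial functions of bounded degree

  -- f is a polynomial function of degree at most m whose coefficient of yᵐ is c: dividing f by y - r
  -- leaves the remainder f r and a quotient of degree at most m - 1 with the same top coefficient.
  Deg≤ : ℕ → (ℤ → ℤ) → ℤ → Set
  Deg≤ zero    f c = ∀ y → f y ≡ c
  Deg≤ (suc m) f c = ∀ r → Σ (ℤ → ℤ) λ g → Deg≤ m g c × (∀ y → f y ≡ f r + (y - r) * g y)

  Deg≤-zero : ∀ m → Deg≤ m (λ _ → 0ℤ) 0ℤ
  Deg≤-zero zero    y = refl
  Deg≤-zero (suc m) r = (λ _ → 0ℤ) , Deg≤-zero m , λ y → lemma (y - r)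
    where
    lemma : ∀ u → 0ℤ ≡ 0ℤ + u * 0ℤ
    lemma = solve-∀

  Deg≤-const : ∀ m k → Deg≤ (suc m) (λ _ → k) 0ℤ
  Deg≤-const m k r = (λ _ → 0ℤ) , Deg≤-zero m , λ y → lemma k (y - r)
    where
    lemma : ∀ k u → k ≡ k + u * 0ℤ
    lemma = solve-∀

  Deg≤-+ : ∀ m {f g c d} → Deg≤ m f c → Deg≤ m g d → Deg≤ m (λ y → f y + g y) (c + d)
  Deg≤-+ zero    F G y = cong₂ _+_ (F y) (G y)
  Deg≤-+ (suc m) {f} {g} F G r with F r | G r
  ... | f′ , F′ , eqf | g′ , G′ , eqg = (λ y → f′ y + g′ y) , Deg≤-+ m F′ G′ ,
    λ y → trans (cong₂ _+_ (eqf y) (eqg y)) (lemma (f r) (g r) (y - r) (f′ y) (g′ y))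
    where
    lemma : ∀ a b u v w → (a + u * v) + (b + u * w) ≡ (a + b) + u * (v + w)
    lemma = solve-∀

  Deg≤-linear-* : ∀ m {f c} a b → Deg≤ m f c → Deg≤ (suc m) (λ y → (b - a * y) * f y) (- a * c)
  Deg≤-linear-* zero {f} {c} a b F r = (λ _ → - a * c) , (λ _ → refl) ,
    λ y → trans (cong ((b - a * y) *_) (F y))
          (trans (lemma a b c y r) (cong (λ z → (b - a * r) * z + (y - r) * (- a * c)) (sym (F r))))
    where
    lemma : ∀ a b c y r → (b - a * y) * c ≡ (b - a * r) * c + (y - r) * (- a * c)
    lemma = solve-∀
  Deg≤-linear-* (suc m) {f} {c} a b F r with F r
  -- Obtained from f y = f r + (y - r) g y and b - a y = (b - a r) - a (y - r).
  ... | g , G , eq = (λ y → (b - a * y) * g y + - a * f r) ,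
    subst (Deg≤ (suc m) _) (ℤ.+-identityʳ _)
      (Deg≤-+ (suc m) (Deg≤-linear-* m a b G) (Deg≤-const m (- a * f r))) ,
    λ y → trans (cong ((b - a * y) *_) (eq y)) (lemma a b y r (f r) (g y))
    where
    lemma : ∀ a b y r u v → (b - a * y) * (u + (y - r) * v) ≡
                            (b - a * r) * u + (y - r) * ((b - a * y) * v + - a * u)
    lemma = solve-∀

  -- Polynomials in X and division by linear factors

  -- Polynomials in X as coefficient sequences; finiteness of the support is tracked separately.
  Coeffs : Set
  Coeffs = ℕ → ℤ

  infixl 6 _⊕_

  _⊕_ : Coeffs → Coeffs → Coeffs
  (f ⊕ g) i = f i + g i

  constant : ℤ → Coeffs
  constant c zero    = c
  constant c (suc i) = 0ℤ

  [X-_]*_ : ℤ → Coeffs → Coeffs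
  ([X- t ]* f) zero    = - (t * f zero)
  ([X- t ]* f) (suc i) = f i - t * f (suc i)

  ∏[X-_]*_ : List ℤ → Coeffs → Coeffs
  ∏[X- []    ]* f = f
  ∏[X- t ∷ L ]* f = ∏[X- L ]* ([X- t ]* f)

  ∂ : Coeffs → Coeffs
  ∂ f i = + suc i * f (suc i)

  [X-]-cong : ∀ t {f g} → f ≗ g → [X- t ]* f ≗ [X- t ]* g
  [X-]-cong t eq zero    = cong (λ z → - (t * z)) (eq zero)
  [X-]-cong t eq (suc i) = cong₂ (λ u v → u - t * v) (eq i) (eq (suc i))

  [X-]-⊕ : ∀ t f g → [X- t ]* (f ⊕ g) ≗ [X- t ]* f ⊕ [X- t ]* g
  [X-]-⊕ t f g zero    = lemma t (f 0) (g 0)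
    where
    lemma : ∀ t u v → - (t * (u + v)) ≡ - (t * u) + - (t * v)
    lemma = solve-∀
  [X-]-⊕ t f g (suc i) = lemma t (f i) (g i) (f (suc i)) (g (suc i))
    where
    lemma : ∀ t u v u′ v′ → (u + v) - t * (u′ + v′) ≡ (u - t * u′) + (v - t * v′)
    lemma = solve-∀

  [X-]-comm : ∀ s t f → [X- s ]* ([X- t ]* f) ≗ [X- t ]* ([X- s ]* f)
  [X-]-comm s t f zero          = lemma s t (f 0)
    where
    lemma : ∀ s t u → - (s * - (t * u)) ≡ - (t * - (s * u))
    lemma = solve-∀
  [X-]-comm s t f (suc zero)    = lemma s t (f 0) (f 1)
    where
    lemma : ∀ s t u v → - (t * u) - s * (u - t * v) ≡ - (s * u) - t * (u - s * v)
    lemma = solve-∀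
  [X-]-comm s t f (suc (suc i)) = lemma s t (f i) (f (suc i)) (f (suc (suc i)))
    where
    lemma : ∀ s t u v w → (u - t * v) - s * (v - t * w) ≡ (u - s * v) - t * (v - s * w)
    lemma = solve-∀

  ∏-cong : ∀ L {f g} → f ≗ g → ∏[X- L ]* f ≗ ∏[X- L ]* g
  ∏-cong []      eq = eq
  ∏-cong (t ∷ L) eq = ∏-cong L ([X-]-cong t eq)

  ∏-⊕ : ∀ L f g → ∏[X- L ]* (f ⊕ g) ≗ ∏[X- L ]* f ⊕ ∏[X- L ]* g
  ∏-⊕ []      f g i = refl
  ∏-⊕ (t ∷ L) f g i = trans (∏-cong L ([X-]-⊕ t f g) i) (∏-⊕ L ([X- t ]* f) ([X- t ]* g) i)

  ∏-comm : ∀ t L f → [X- t ]* (∏[X- L ]* f) ≗ ∏[X- L ]* ([X- t ]* f)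
  ∏-comm t []      f i = refl
  ∏-comm t (s ∷ L) f i = trans (∏-comm t L ([X- s ]* f) i) (∏-cong L ([X-]-comm t s f) i)

  ∂-cong : ∀ {f g} → f ≗ g → ∂ f ≗ ∂ g
  ∂-cong eq i = cong (+ suc i *_) (eq (suc i))

  ∂-[X-] : ∀ t f → ∂ ([X- t ]* f) ≗ f ⊕ [X- t ]* ∂ f
  ∂-[X-] t f zero    = lemma t (f 0) (f 1)
    where
    lemma : ∀ t u v → + 1 * (u - t * v) ≡ u + - (t * (+ 1 * v))
    lemma = solve-∀
  ∂-[X-] t f (suc i) = lemma (+ suc i) t (f (suc i)) (f (suc (suc i)))
    where
    lemma : ∀ n t u v → (1ℤ + n) * (u - t * v) ≡ u + (n * u - t * ((1ℤ + n) * v))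
    lemma = solve-∀

  -- The coefficient of Xⁱ in the quotient of X^(n + |L|) by ∏ (X - t), t ∈ L;
  -- in particular quotient n [] is Xⁿ.
  quotient : ℕ → List ℤ → Coeffs
  quotient n       L zero    = h n L
  quotient zero    L (suc i) = 0ℤ
  quotient (suc n) L (suc i) = quotient n L i

  quotient-suc : ∀ n t L i →
    quotient n L i ≡ quotient n (t ∷ L) i - t * quotient n (t ∷ L) (suc i)
  quotient-suc zero    t L zero    = lemma t
    where
    lemma : ∀ t → 1ℤ ≡ 1ℤ - t * 0ℤ
    lemma = solve-∀
  quotient-suc (suc n) t L zero    = lemma t (h (suc n) L) (h n (t ∷ L))
    where
    lemma : ∀ t u v → u ≡ (u + t * v) - t * v
    lemma = solve-∀
  quotient-suc zero    t L (suc i) = lemma t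
    where
    lemma : ∀ t → 0ℤ ≡ 0ℤ - t * 0ℤ
    lemma = solve-∀
  quotient-suc (suc n) t L (suc i) = quotient-suc n t L i

  -- Synthetic division by X - t: the remainder is the next Newton coefficient of the power being
  -- divided.
  quotient-step : ∀ n t L →
    quotient (suc n) L ≗ constant (h (suc n) (t ∷ L)) ⊕ [X- t ]* quotient n (t ∷ L)
  quotient-step n t L zero    = lemma t (h (suc n) L) (h n (t ∷ L))
    where
    lemma : ∀ t u v → u ≡ (u + t * v) + - (t * v)
    lemma = solve-∀
  quotient-step n t L (suc i) = trans (quotient-suc n t L i) (sym (ℤ.+-identityˡ _))

  -- Binomial coefficients modulo a prime

  ·≡* : ∀ n x → n · x ≡ + n * x
  ·≡* zero    x = refl
  ·≡* (suc n) x = trans (cong (_+_ x) (·≡* n x)) (sym (ℤ.suc-* (+ n) x))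

  ∣⇒∣· : ∀ {d n} → d ℕ.∣ n → ∀ x → + d ∣ n · x
  ∣⇒∣· {d} {n} d∣n x = subst (+ d ∣_) (sym (·≡* n x)) (∣m⇒∣m*n {m = + n} x (∣ᵤ⇒∣ d∣n))

  1^n≡1 : ∀ n → 1ℤ ^ n ≡ 1ℤ
  1^n≡1 zero    = refl
  1^n≡1 (suc n) = trans (ℤ.*-identityˡ _) (1^n≡1 n)

  prime∤! : ∀ {p} → Prime p → ∀ k → k ℕ.< p → ¬ (p ℕ.∣ k !)
  prime∤! pr zero    k<p p∣ = ℕ.<⇒≱ (ℕ.nonTrivial⇒n>1 _ {{prime⇒nonTrivial pr}}) (ℕ.∣⇒≤ p∣)
  prime∤! pr (suc k) k<p p∣ with euclidsLemma (suc k) (k !) pr p∣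
  ... | inj₁ p∣k  = ℕ.<⇒≱ k<p (ℕ.∣⇒≤ p∣k)
  ... | inj₂ p∣k! = prime∤! pr k (ℕ.<-trans (ℕ.n<1+n k) k<p) p∣k!

  prime∣C : ∀ {p} → Prime p → ∀ k → 0 ℕ.< k → k ℕ.< p → p ℕ.∣ p C k
  prime∣C {p} pr k 0<k k<p with euclidsLemma (p C k) (k ! ℕ.* (p ℕ.∸ k) !) pr p∣product
    where
    instance _ = k ℕ.!* (p ℕ.∸ k) !≢0
    p∣p! : ∀ q → Prime q → q ℕ.∣ q !
    p∣p! zero    q = contradiction q λ ()
    p∣p! (suc q) _ = ℕ.m∣m*n (q !)
    p∣product : p ℕ.∣ (p C k) ℕ.* (k ! ℕ.* (p ℕ.∸ k) !)
    p∣product = subst (p ℕ.∣_)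
      (sym (trans (cong (ℕ._* (k ! ℕ.* (p ℕ.∸ k) !)) (nCk≡n!/k![n-k]! (ℕ.<⇒≤ k<p)))
                  (m/n*n≡m (k![n∸k]!∣n! (ℕ.<⇒≤ k<p)))))
      (p∣p! p pr)
  ... | inj₁ p∣C = p∣C
  ... | inj₂ p∣k![p-k]! with euclidsLemma (k !) ((p ℕ.∸ k) !) pr p∣k![p-k]!
  ...   | inj₁ p∣k!     = contradiction p∣k! (prime∤! pr k k<p)
  ...   | inj₂ p∣[p-k]! = contradiction p∣[p-k]!
                            (prime∤! pr (p ℕ.∸ k) (ℕ.∸-monoʳ-< 0<k (ℕ.<⇒≤ k<p)))

  ∣-sum : ∀ {d} n (t : Vector ℤ n) → (∀ i → d ∣ t i) → d ∣ sum t
  ∣-sum {d} zero t d∣t = divides 0ℤ refl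
  ∣-sum (suc n) t d∣t = ∣m∣n⇒∣m+n (d∣t Fin.zero) (∣-sum n (tail t) (d∣t ∘ Fin.suc))

  -- Nodes with multiplicity and enumeration of subsets

  repeatEach : ℕ → List ℤ → List ℤ
  repeatEach m = concatMap (replicate m)

  ∈-repeatEach : ∀ m {t L} → t ∈ L → t ∈ repeatEach (suc m) L
  ∈-repeatEach m t∈L = ∈-concatMap⁺ (replicate (suc m)) (Any.map here t∈L)

  length-repeatEach : ∀ m L → length (repeatEach m L) ≡ length L ℕ.* m
  length-repeatEach m []      = refl
  length-repeatEach m (t ∷ L) = trans (length-++ (replicate m t))
    (cong₂ ℕ._+_ (length-replicate m) (length-repeatEach m L))

  map-cartesianProductWith : ∀ {X Y P : Set} (f : X → Y → P) (φ : P → ℤ) (ψ : X → ℤ) →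
    (∀ x y → φ (f x y) ≡ ψ x) → ∀ xs ys →
    map φ (cartesianProductWith f xs ys) ≡ repeatEach (length ys) (map ψ xs)
  map-cartesianProductWith f φ ψ φf≡ψ []       ys = refl
  map-cartesianProductWith f φ ψ φf≡ψ (x ∷ xs) ys =
    trans (map-++ φ (map (f x) ys) _) (cong₂ _++_ (row ys) (map-cartesianProductWith f φ ψ φf≡ψ xs ys))
    where
    row : ∀ ys → map φ (map (f x) ys) ≡ replicate (length ys) (ψ x)
    row []       = refl
    row (y ∷ ys) = cong₂ _∷_ (φf≡ψ x y) (row ys)

  length-filter-¬ : ∀ {X : Set} {P : X → Set} (P? : ∀ x → Dec (P x)) xs →
    length (filter P? xs) ℕ.+ length (filter (¬? ∘ P?) xs) ≡ length xs
  length-filter-¬ P? []       = refl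
  length-filter-¬ P? (x ∷ xs) with ih ← length-filter-¬ P? xs | Dec.does (P? x)
  ... | true  = cong suc ih
  ... | false = trans (ℕ.+-suc _ _) (cong suc ih)

  elements : ∀ {n} → Subset n → List (Fin n)
  elements []            = []
  elements (inside ∷ A)  = Fin.zero ∷ map Fin.suc (elements A)
  elements (outside ∷ A) = map Fin.suc (elements A)

  length-elements : ∀ {n} (A : Subset n) → length (elements A) ≡ ∣ A ∣ₛ
  length-elements []            = refl
  length-elements (inside ∷ A)  = cong suc (trans (length-map Fin.suc (elements A)) (length-elements A))
  length-elements (outside ∷ A) = trans (length-map Fin.suc (elements A)) (length-elements A)

  elements-unique : ∀ {n} (A : Subset n) → Unique (elements A)
  elements-unique []            = []
  elements-unique (inside ∷ A)  = All.map⁺ (All.universal (λ _ ()) (elements A))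
                                ∷ Unique.map⁺ Fin.suc-injective (elements-unique A)
  elements-unique (outside ∷ A) = Unique.map⁺ Fin.suc-injective (elements-unique A)

  elements-sound : ∀ {n} (A : Subset n) {x} → x ∈ elements A → x ∈ₛ A
  elements-sound (inside ∷ A)  (here refl) = here
  elements-sound (inside ∷ A)  (there x∈) with ∈-map⁻ Fin.suc x∈
  ... | y , y∈ , refl = there (elements-sound A y∈)
  elements-sound (outside ∷ A) x∈ with ∈-map⁻ Fin.suc x∈
  ... | y , y∈ , refl = there (elements-sound A y∈)

  1≤*pred : ∀ {k m} → 2 ℕ.≤ k → 2 ℕ.≤ suc m → 1 ℕ.≤ k ℕ.* m
  1≤*pred 2≤k (s≤s 1≤m) = ℕ.*-mono-≤ (ℕ.<⇒≤ 2≤k) 1≤m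

  module Modulo {p : ℕ} (pr : Prime p) where

    -- Congruences and Fermat's little theorem

    infix 4 _≈_
    _≈_ : ℤ → ℤ → Set
    x ≈ y = + p ∣ x - y

    ∣-resp-≈ : ∀ {x y} → x ≈ y → + p ∣ x → + p ∣ y
    ∣-resp-≈ {x} {y} x≈y p∣x = subst (+ p ∣_) (lemma x y) (∣m∣n⇒∣m-n p∣x x≈y)
      where
      lemma : ∀ x y → x - (x - y) ≡ y
      lemma = solve-∀

    ∣-resp-≈ʳ : ∀ {x y} → x ≈ y → + p ∣ y → + p ∣ x
    ∣-resp-≈ʳ {x} {y} x≈y p∣y = subst (+ p ∣_) (lemma x y) (∣m∣n⇒∣m+n p∣y x≈y)
      where
      lemma : ∀ x y → y + (x - y) ≡ x
      lemma = solve-∀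

    p∣0 : + p ∣ 0ℤ
    p∣0 = divides 0ℤ refl

    euclid : ∀ x y → + p ∣ x * y → ¬ (+ p ∣ x) → + p ∣ y
    euclid x y p∣xy p∤x
      with euclidsLemma ∣ x ∣ ∣ y ∣ pr (subst (p ℕ.∣_) (ℤ.abs-* x y) (∣⇒∣ᵤ p∣xy))
    ... | inj₁ p∣x = contradiction (∣ᵤ⇒∣ p∣x) p∤x
    ... | inj₂ p∣y = ∣ᵤ⇒∣ p∣y

    frobenius : ∀ x → (x + 1ℤ) ^ p ≈ x ^ p + 1ℤ
    frobenius x = go p refl
      where
      go : ∀ n → n ≡ p → + p ∣ (x + 1ℤ) ^ n - (x ^ n + 1ℤ)
      go zero    refl = contradiction pr λ ()
      -- The outer binomial terms are 1 and x^p; those in `mid` carry p C k with 0 < k < p.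
      go (suc n) refl = subst (+ p ∣_) (sym eq) (∣-sum n mid p∣mid)
        where
        term = binomialTerm x 1ℤ (suc n)
        mid  = init (tail term)
        p∣mid : ∀ i → + p ∣ mid i
        p∣mid i = ∣⇒∣· (prime∣C pr (suc (Fin.toℕ (Fin.inject₁ i))) (s≤s z≤n)
          (s≤s (subst (ℕ._< n) (sym (Fin.toℕ-inject₁ i)) (Fin.toℕ<n i)))) _
        first : term Fin.zero ≡ 1ℤ
        first = trans (ℤ.+-identityʳ _) (trans (ℤ.*-identityˡ _) (1^n≡1 (suc n)))
        final : last (tail term) ≡ x ^ suc n
        final = begin
          (suc n C suc (Fin.toℕ (Fin.fromℕ n))) · (x ^ suc (Fin.toℕ (Fin.fromℕ n)) * 1ℤ ^ (n ℕ.∸ Fin.toℕ (Fin.fromℕ n)))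
            ≡⟨ cong (λ k → (suc n C suc k) · (x ^ suc k * 1ℤ ^ (n ℕ.∸ k))) (Fin.toℕ-fromℕ n) ⟩
          (suc n C suc n) · (x ^ suc n * 1ℤ ^ (n ℕ.∸ n))
            ≡⟨ cong₂ (λ c d → c · (x ^ suc n * d)) (nCn≡1 (suc n)) (1^n≡1 (n ℕ.∸ n)) ⟩
          1 · (x ^ suc n * 1ℤ) ≡⟨ ℤ.+-identityʳ _ ⟩
          x ^ suc n * 1ℤ       ≡⟨ ℤ.*-identityʳ _ ⟩
          x ^ suc n            ∎
          where open ≡-Reasoning
        lemma : ∀ s y → (1ℤ + (s + y)) - (y + 1ℤ) ≡ s
        lemma = solve-∀
        eq : (x + 1ℤ) ^ suc n - (x ^ suc n + 1ℤ) ≡ sum mid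
        eq = begin
          (x + 1ℤ) ^ suc n - (x ^ suc n + 1ℤ)
            ≡⟨ cong (_- (x ^ suc n + 1ℤ)) (theorem (suc n) x 1ℤ) ⟩
          (term Fin.zero + sum (tail term)) - (x ^ suc n + 1ℤ)
            ≡⟨ cong₂ (λ u v → (u + v) - (x ^ suc n + 1ℤ)) first
                 (trans (sum-init-last (tail term)) (cong (_+_ (sum mid)) final)) ⟩
          (1ℤ + (sum mid + x ^ suc n)) - (x ^ suc n + 1ℤ)
            ≡⟨ lemma (sum mid) (x ^ suc n) ⟩
          sum mid ∎
          where open ≡-Reasoning

    fermat-suc : ∀ x → (x + 1ℤ) ^ p - (x + 1ℤ) ≈ x ^ p - x
    fermat-suc x = subst (+ p ∣_) (lemma ((x + 1ℤ) ^ p) (x ^ p) x) (frobenius x)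
      where
      lemma : ∀ u v x → u - (v + 1ℤ) ≡ (u - (x + 1ℤ)) - (v - x)
      lemma = solve-∀

    -- By `fermat-suc` the residue of x^p - x is invariant under x ↦ x + 1, so the case 0 propagates
    -- in both directions.
    fermat : ∀ x → x ^ p ≈ x
    fermat (+ zero) = go p refl
      where
      go : ∀ n → n ≡ p → + p ∣ 0ℤ ^ n - 0ℤ
      go zero    refl = contradiction pr λ ()
      go (suc n) _    = p∣0
    fermat (+ suc n) = subst (λ z → + p ∣ z ^ p - z) (ℤ.+-comm (+ n) 1ℤ)
      (∣-resp-≈ʳ (fermat-suc (+ n)) (fermat (+ n)))
    fermat -[1+ zero ] = ∣-resp-≈ (fermat-suc -[1+ zero ]) (fermat (+ zero))
    fermat -[1+ suc n ] = ∣-resp-≈ (fermat-suc -[1+ suc n ]) (fermat -[1+ n ])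

    -- Divided differences and roots modulo p

    Distinct : List ℤ → Set
    Distinct = AllPairs (λ x y → ¬ x ≈ y)

    -- With two nodes h is the divided difference of X^p, which on GF(p) is that of X, namely 1;
    -- the higher divided differences of X vanish.
    h-pair≈1 : ∀ m x y → suc m ≡ p → ¬ x ≈ y → h m (x ∷ y ∷ []) ≈ 1ℤ
    h-pair≈1 m x y refl x≉y = euclid (x - y) (h m (x ∷ y ∷ []) - 1ℤ)
      (subst (+ p ∣_) eq (∣m∣n⇒∣m-n (fermat x) (fermat y))) x≉y
      where
      lemma₁ : ∀ u v x y → (u - x) - (v - y) ≡ (u - v) - (x - y)
      lemma₁ = solve-∀
      lemma₂ : ∀ d w → d * w - d ≡ d * (w - 1ℤ)
      lemma₂ = solve-∀
      eq : (x ^ p - x) - (y ^ p - y) ≡ (x - y) * (h m (x ∷ y ∷ []) - 1ℤ)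
      eq = begin
        (x ^ p - x) - (y ^ p - y)               ≡⟨ lemma₁ (x ^ p) (y ^ p) x y ⟩
        (x ^ p - y ^ p) - (x - y)
          ≡⟨ cong₂ (λ u v → (u - v) - (x - y)) (h-singleton p x) (h-singleton p y) ⟨
        (h p (x ∷ []) - h p (y ∷ [])) - (x - y)
          ≡⟨ cong (_- (x - y)) (h-divided-difference m x y []) ⟨
        (x - y) * h m (x ∷ y ∷ []) - (x - y)    ≡⟨ lemma₂ (x - y) (h m (x ∷ y ∷ [])) ⟩
        (x - y) * (h m (x ∷ y ∷ []) - 1ℤ)       ∎
        where open ≡-Reasoning

    -- The equation makes `h m` a divided difference of X^p. With three nodes, x - y times it is a
    -- difference of two values that are both 1; with more nodes, of two that are both 0 by
    -- induction. Then x - y cancels.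
    h-distinct≈0 : ∀ m x y z L → m ℕ.+ (2 ℕ.+ length L) ≡ p → Distinct (x ∷ y ∷ z ∷ L) →
      + p ∣ h m (x ∷ y ∷ z ∷ L)
    h-distinct≈0 m x y z [] eq ((x≉y ∷ x≉z ∷ []) ∷ (y≉z ∷ []) ∷ [] ∷ []) =
      euclid (x - y) (h m (x ∷ y ∷ z ∷ []))
        (subst (+ p ∣_)
          (trans (lemma (h (suc m) (x ∷ z ∷ [])) (h (suc m) (y ∷ z ∷ [])))
                 (sym (h-divided-difference m x y (z ∷ []))))
          (∣m∣n⇒∣m-n (h-pair≈1 (suc m) x z eq′ x≉z) (h-pair≈1 (suc m) y z eq′ y≉z)))
        x≉y
      where
      eq′ : suc (suc m) ≡ p
      eq′ = trans (ℕ.+-comm 2 m) eq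
      lemma : ∀ u v → (u - 1ℤ) - (v - 1ℤ) ≡ u - v
      lemma = solve-∀
    h-distinct≈0 m x y z (w ∷ L) eq
      ((x≉y ∷ x≉z ∷ x≉w ∷ x≉L) ∷ (y≉z ∷ y≉w ∷ y≉L) ∷ (z≉w ∷ z≉L) ∷ w≉L ∷ dL) =
      euclid (x - y) (h m (x ∷ y ∷ z ∷ w ∷ L))
        (subst (+ p ∣_) (sym (h-divided-difference m x y (z ∷ w ∷ L)))
          (∣m∣n⇒∣m-n
            (h-distinct≈0 (suc m) x z w L eq′ ((x≉z ∷ x≉w ∷ x≉L) ∷ (z≉w ∷ z≉L) ∷ w≉L ∷ dL))
            (h-distinct≈0 (suc m) y z w L eq′ ((y≉z ∷ y≉w ∷ y≉L) ∷ (z≉w ∷ z≉L) ∷ w≉L ∷ dL))))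
        x≉y
      where
      eq′ : suc m ℕ.+ (2 ℕ.+ length L) ≡ p
      eq′ = trans (sym (ℕ.+-suc m (2 ℕ.+ length L))) eq

    -- Dividing out y - r for a root r keeps the top coefficient and lowers the degree; the other
    -- roots, incongruent to r, are roots of the quotient. A root is still left when the function
    -- has become constant.
    Deg≤-roots : ∀ m {f c} (R : List ℤ) → m ℕ.< length R → Deg≤ m f c → Distinct R →
      All (λ r → + p ∣ f r) R → (∀ y → + p ∣ f y) × (+ p ∣ c)
    Deg≤-roots zero    (r ∷ R) _ F _ (fr ∷ _) =
      let p∣c = subst (+ p ∣_) (F r) fr in (λ y → subst (+ p ∣_) (sym (F y)) p∣c) , p∣c
    Deg≤-roots (suc m) {f} (r ∷ R) (s≤s m<R) F (r≉R ∷ dR) (fr ∷ fR) with F r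
    ... | g , G , eq = p∣f , proj₂ IH
      where
      lemma : ∀ u v → (u + v) - u ≡ v
      lemma = solve-∀
      lemma′ : ∀ x y → - (x - y) ≡ y - x
      lemma′ = solve-∀
      rootsOfg : ∀ {S} → All (λ s → ¬ r ≈ s) S → All (λ s → + p ∣ f s) S → All (λ s → + p ∣ g s) S
      rootsOfg []          []         = []
      rootsOfg {s ∷ _} (r≉s ∷ r≉S) (fs ∷ fS) =
        euclid (s - r) (g s)
          (subst (+ p ∣_) (trans (cong (_- f r) (eq s)) (lemma (f r) ((s - r) * g s))) (∣m∣n⇒∣m-n fs fr))
          (λ s≈r → r≉s (subst (+ p ∣_) (lemma′ s r) (∣m⇒∣-m s≈r)))
        ∷ rootsOfg r≉S fS
      IH = Deg≤-roots m R m<R G dR (rootsOfg r≉R fR)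
      p∣f : ∀ y → + p ∣ f y
      p∣f y = subst (+ p ∣_) (sym (eq y)) (∣m∣n⇒∣m+n fr (∣n⇒∣m*n (y - r) (proj₁ IH y)))

    -- Degree bounds modulo p

    SupportBelow : ℕ → Coeffs → Set
    SupportBelow n f = ∀ i → n ℕ.≤ i → + p ∣ f i

    Support-mono : ∀ {m n f} → m ℕ.≤ n → SupportBelow m f → SupportBelow n f
    Support-mono m≤n S i n≤i = S i (ℕ.≤-trans m≤n n≤i)

    Support-resp : ∀ {n f g} → f ≗ g → SupportBelow n f → SupportBelow n g
    Support-resp eq S i n≤i = subst (+ p ∣_) (eq i) (S i n≤i)

    Support-⊕ : ∀ {n f g} → SupportBelow n f → SupportBelow n g → SupportBelow n (f ⊕ g)
    Support-⊕ F G i n≤i = ∣m∣n⇒∣m+n (F i n≤i) (G i n≤i)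

    Support-[X-] : ∀ t {n f} → SupportBelow n f → SupportBelow (suc n) ([X- t ]* f)
    Support-[X-] t S (suc i) (s≤s n≤i) =
      ∣m∣n⇒∣m-n (S i n≤i) (∣n⇒∣m*n t (S (suc i) (ℕ.m≤n⇒m≤1+n n≤i)))

    Support-∏ : ∀ L {n f} → SupportBelow n f → SupportBelow (length L ℕ.+ n) (∏[X- L ]* f)
    Support-∏ []      S = S
    Support-∏ (t ∷ L) {n} {f} S =
      subst (λ k → SupportBelow k (∏[X- t ∷ L ]* f)) (ℕ.+-suc (length L) n)
        (Support-∏ L (Support-[X-] t S))

    Support0-[X-] : ∀ t {f} → SupportBelow 0 f → SupportBelow 0 ([X- t ]* f)
    Support0-[X-] t S zero    _ = ∣m⇒∣-m (∣n⇒∣m*n t (S 0 z≤n))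
    Support0-[X-] t S (suc i) _ = ∣m∣n⇒∣m-n (S i z≤n) (∣n⇒∣m*n t (S (suc i) z≤n))

    Support0-∏ : ∀ L {f} → SupportBelow 0 f → SupportBelow 0 (∏[X- L ]* f)
    Support0-∏ []      S = S
    Support0-∏ (t ∷ L) S = Support0-∏ L (Support0-[X-] t S)

    -- f is a polynomial, so its coefficients can be cleared from the top down.
    Support-[X-]⁻¹ : ∀ t {n s f} → SupportBelow n f → SupportBelow (suc s) ([X- t ]* f) →
      SupportBelow s f
    Support-[X-]⁻¹ t {n} {s} {f} S T i s≤i = go n i (ℕ.m≤m+n n i) s≤i
      where
      lemma : ∀ u v → (u - v) + v ≡ u
      lemma = solve-∀
      go : ∀ k i → n ℕ.≤ k ℕ.+ i → s ℕ.≤ i → + p ∣ f i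
      go zero    i n≤i s≤i = S i n≤i
      go (suc k) i n≤ki s≤i = subst (+ p ∣_) (lemma (f i) (t * f (suc i)))
        (∣m∣n⇒∣m+n (T (suc i) (s≤s s≤i))
          (∣n⇒∣m*n t (go k (suc i) (subst (n ℕ.≤_) (sym (ℕ.+-suc k i)) n≤ki) (ℕ.m≤n⇒m≤1+n s≤i))))

    Support-∏⁻¹ : ∀ L {n s f} → SupportBelow n f → SupportBelow (length L ℕ.+ s) (∏[X- L ]* f) →
      SupportBelow s f
    Support-∏⁻¹ []      S T = T
    Support-∏⁻¹ (t ∷ L) {s = s} {f} S T = Support-[X-]⁻¹ t S
      (Support-∏⁻¹ L (Support-[X-] t S)
        (subst (λ k → SupportBelow k (∏[X- t ∷ L ]* f)) (sym (ℕ.+-suc (length L) s)) T))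

    Support-∂ : ∀ {n f} → SupportBelow n f → SupportBelow n (∂ f)
    Support-∂ S i n≤i = ∣n⇒∣m*n (+ suc i) (S (suc i) (ℕ.m≤n⇒m≤1+n n≤i))

    Support-quotient : ∀ n L → SupportBelow (suc n) (quotient n L)
    Support-quotient zero    L (suc i) _         = p∣0
    Support-quotient (suc n) L (suc i) (s≤s n<i) = Support-quotient n L i n<i

    Support-constant : ∀ c → SupportBelow 1 (constant c)
    Support-constant c (suc i) _ = p∣0

    -- Divisibility and multiplicity of roots

    infix 4 _∣ᵖ_
    -- The bound makes the cofactor a polynomial modulo p instead of a formal power series, as
    -- `Support-∏⁻¹` requires.
    record _∣ᵖ_ (L : List ℤ) (f : Coeffs) : Set where
      constructor factor
      field
        cofactor : Coeffs
        bound    : ℕ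
        support  : SupportBelow bound cofactor
        equality : f ≗ ∏[X- L ]* cofactor

    ∣ᵖ-resp : ∀ {L f g} → f ≗ g → L ∣ᵖ g → L ∣ᵖ f
    ∣ᵖ-resp eq (factor c n S e) = factor c n S λ i → trans (eq i) (e i)

    ∣ᵖ-⊕ : ∀ {L f g} → L ∣ᵖ f → L ∣ᵖ g → L ∣ᵖ f ⊕ g
    ∣ᵖ-⊕ {L} (factor c m S e) (factor d n T e′) = factor (c ⊕ d) (m ℕ.⊔ n)
      (Support-⊕ (Support-mono (ℕ.m≤m⊔n m n) S) (Support-mono (ℕ.m≤n⊔m m n) T))
      λ i → trans (cong₂ _+_ (e i) (e′ i)) (sym (∏-⊕ L c d i))

    ∣ᵖ-cons : ∀ t {L f} → L ∣ᵖ f → t ∷ L ∣ᵖ [X- t ]* f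
    ∣ᵖ-cons t {L} (factor c n S e) = factor c n S
      λ i → trans ([X-]-cong t e i) (∏-comm t L c i)

    ∣ᵖ-[X-] : ∀ t {L f} → L ∣ᵖ f → L ∣ᵖ [X- t ]* f
    ∣ᵖ-[X-] t {L} (factor c n S e) = factor ([X- t ]* c) (suc n) (Support-[X-] t S)
      λ i → trans ([X-]-cong t e i) (∏-comm t L c i)

    ∣ᵖ-uncons : ∀ {t L f} → t ∷ L ∣ᵖ f → Σ Coeffs λ g → f ≗ [X- t ]* g × L ∣ᵖ g
    ∣ᵖ-uncons {t} {L} (factor c n S e) = ∏[X- L ]* c ,
      (λ i → trans (e i) (sym (∏-comm t L c i))) , factor c n S (λ _ → refl)

    ∣ᵖ-member : ∀ {t L f} → t ∈ L → L ∣ᵖ f → t ∷ [] ∣ᵖ f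
    ∣ᵖ-member {L = s ∷ L} (here refl) L∣f with ∣ᵖ-uncons L∣f
    ... | g , eq , factor c n S e = factor g _ (Support-resp (λ i → sym (e i)) (Support-∏ L S)) eq
    ∣ᵖ-member {t} {L = s ∷ L} (there t∈L) L∣f with ∣ᵖ-uncons L∣f
    ... | g , eq , L∣g = ∣ᵖ-resp eq (∣ᵖ-[X-] s (∣ᵖ-member t∈L L∣g))

    ∣ᵖ-++ : ∀ K {L L′} → (∀ {f} → L ∣ᵖ f → L′ ∣ᵖ f) → ∀ {f} → K ++ L ∣ᵖ f → K ++ L′ ∣ᵖ f
    ∣ᵖ-++ []      L⇒L′ L∣f = L⇒L′ L∣f
    ∣ᵖ-++ (t ∷ K) L⇒L′ K∣f with ∣ᵖ-uncons K∣f
    ... | g , eq , K∣g = ∣ᵖ-resp eq (∣ᵖ-cons t (∣ᵖ-++ K L⇒L′ K∣g))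

    -- L′ stands for L with every multiplicity lowered by one. For f = (X - t) g the product rule
    -- gives f′ = g + (X - t) g′; in the second term the factor X - t restores the multiplicity of t
    -- that g′ loses.
    ∣ᵖ-∂-replicate : ∀ m t {L L′} → (∀ {f} → L ∣ᵖ f → L′ ∣ᵖ f) → (∀ {f} → L ∣ᵖ f → L′ ∣ᵖ ∂ f) →
      ∀ {f} → replicate (suc m) t ++ L ∣ᵖ f → replicate m t ++ L′ ∣ᵖ ∂ f
    ∣ᵖ-∂-replicate m t L⇒L′ L⇒∂ tL∣f with ∣ᵖ-uncons tL∣f
    ... | g , eq , L∣g = ∣ᵖ-resp (λ i → trans (∂-cong eq i) (∂-[X-] t g i))
      (∣ᵖ-⊕ (∣ᵖ-++ (replicate m t) L⇒L′ L∣g) (second m L∣g))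
      where
      second : ∀ m → replicate m t ++ _ ∣ᵖ g → replicate m t ++ _ ∣ᵖ [X- t ]* ∂ g
      second zero    L∣g = ∣ᵖ-[X-] t (L⇒∂ L∣g)
      second (suc m) L∣g = ∣ᵖ-cons t (∣ᵖ-∂-replicate m t L⇒L′ L⇒∂ L∣g)

    ∣ᵖ-replicate-suc : ∀ m t {L L′} → (∀ {f} → L ∣ᵖ f → L′ ∣ᵖ f) →
      ∀ {f} → replicate (suc m) t ++ L ∣ᵖ f → replicate m t ++ L′ ∣ᵖ f
    ∣ᵖ-replicate-suc m t L⇒L′ tL∣f with ∣ᵖ-uncons tL∣f
    ... | g , eq , L∣g = ∣ᵖ-resp eq (∣ᵖ-[X-] t (∣ᵖ-++ (replicate m t) L⇒L′ L∣g))

    ∣ᵖ-repeatEach-suc : ∀ m L {f} → repeatEach (suc m) L ∣ᵖ f → repeatEach m L ∣ᵖ f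
    ∣ᵖ-repeatEach-suc m []      = λ z → z
    ∣ᵖ-repeatEach-suc m (t ∷ L) = ∣ᵖ-replicate-suc m t (∣ᵖ-repeatEach-suc m L)

    ∣ᵖ-∂-repeatEach : ∀ m L {f} → repeatEach (suc m) L ∣ᵖ f → repeatEach m L ∣ᵖ ∂ f
    ∣ᵖ-∂-repeatEach m [] (factor c n S e) = factor (∂ c) n (Support-∂ S) (∂-cong e)
    ∣ᵖ-∂-repeatEach m (t ∷ L) =
      ∣ᵖ-∂-replicate m t (∣ᵖ-repeatEach-suc m L) (∣ᵖ-∂-repeatEach m L)

    -- Newton interpolation of X^p

    -- The Newton coefficients of X^p at the nodes of L, taken from the last node to the first,
    -- vanish modulo p from index s on.
    TopVanishing : ℕ → List ℤ → Set
    TopVanishing s []      = ⊤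
    TopVanishing s (t ∷ L) =
      (∀ n → n ℕ.+ length L ≡ p → s ℕ.≤ length L → + p ∣ h n (t ∷ L)) × TopVanishing s L

    -- By `quotient-step`, a new node t moves the term c ∏ (X - u), u ∈ L, into the remainder. Its
    -- degree |L| is below s, or else c vanishes modulo p.
    newton : ∀ s L n → n ℕ.+ length L ≡ p → TopVanishing s L →
      Σ Coeffs λ r → SupportBelow s r × quotient p [] ≗ r ⊕ ∏[X- L ]* quotient n L
    newton s [] n eq _ = (λ _ → 0ℤ) , (λ _ _ → p∣0) , λ i →
      trans (cong (λ k → quotient k [] i) (trans (sym eq) (ℕ.+-identityʳ n))) (sym (ℤ.+-identityˡ _))
    newton s (t ∷ L) n eq (top , V) with newton s L (suc n) eq′ V
      where eq′ = trans (sym (ℕ.+-suc n (length L))) eq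
    ... | r , S , e = r ⊕ ∏[X- L ]* constant c , Support-⊕ S S′ , λ i → begin
      quotient p [] i
        ≡⟨ e i ⟩
      r i + (∏[X- L ]* quotient (suc n) L) i
        ≡⟨ cong (_+_ (r i)) (∏-cong L (quotient-step n t L) i) ⟩
      r i + (∏[X- L ]* (constant c ⊕ [X- t ]* quotient n (t ∷ L))) i
        ≡⟨ cong (_+_ (r i)) (∏-⊕ L (constant c) ([X- t ]* quotient n (t ∷ L)) i) ⟩
      r i + ((∏[X- L ]* constant c) i + (∏[X- t ∷ L ]* quotient n (t ∷ L)) i)
        ≡⟨ ℤ.+-assoc (r i) _ _ ⟨
      (r i + (∏[X- L ]* constant c) i) + (∏[X- t ∷ L ]* quotient n (t ∷ L)) i ∎
      where
      open ≡-Reasoning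
      c = h (suc n) (t ∷ L)
      S′ : SupportBelow s (∏[X- L ]* constant c)
      S′ with s ℕ.≤? length L
      ... | yes s≤L = Support-mono z≤n (Support0-∏ L λ
        { zero _ → top (suc n) (trans (sym (ℕ.+-suc n (length L))) eq) s≤L ; (suc i) _ → p∣0 })
      ... | no s≰L = Support-mono (subst (ℕ._≤ s) (ℕ.+-comm 1 (length L)) (ℕ.≰⇒> s≰L))
        (Support-∏ L (Support-constant c))

    -- The vanishing derivative of X^p

    p∣∂Xᵖ : SupportBelow 0 (∂ (quotient p []))
    p∣∂Xᵖ i _ = go p i (λ i≡p → subst (λ k → + p ∣ + k) (sym i≡p) ∣-refl)
      where
      -- Only degree p carries a nonzero coefficient, and there the factor is p; `go` lowers
      -- exponent and index together.
      go : ∀ n i {k} → (suc i ≡ n → + p ∣ k) → + p ∣ k * quotient n [] (suc i)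
      go zero          i   {k} f = ∣n⇒∣m*n k p∣0
      go (suc zero)    zero    f = ∣m⇒∣m*n 1ℤ (f refl)
      go (suc (suc n)) zero {k} f = ∣n⇒∣m*n k p∣0
      go (suc n)       (suc i) f = go n i λ e → f (cong suc e)

    p∤suc : ∀ i → suc i ℕ.< p → ¬ (+ p ∣ + suc i)
    p∤suc i i<p p∣i = ℕ.<⇒≱ i<p (ℕ.∣⇒≤ (∣⇒∣ᵤ p∣i))

    -- Coefficient sequences cannot be evaluated at t, so X^p = r + (X - t) q is compared with X^p =
    -- t^p + (X - t) Q. Since (X - t) (Q - q) is constant modulo p, Q - q vanishes, and r 0 ≡ t^p ≡
    -- t.
    root-of-Xᵖ-const : ∀ {r t} → SupportBelow 1 r → ∀ {g} → t ∷ [] ∣ᵖ g → quotient p [] ≗ r ⊕ g →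
      r 0 ≈ t
    root-of-Xᵖ-const {r} {t} R {g} (factor q n S e) eq = go p refl
      where
      go : ∀ k → k ≡ p → r 0 ≈ t
      go zero    refl = contradiction pr λ ()
      go (suc k) refl = subst (+ p ∣_) (telescope (r 0) (t ^ p) t)
        (∣m∣n⇒∣m+n (subst (+ p ∣_) (sym r₀-tᵖ) (Support0-[X-] t D0 0 z≤n)) (fermat t))
        where
        c  = h p (t ∷ [])
        Q  = quotient k (t ∷ [])
        D  : Coeffs
        D i = Q i - q i
        transpose : ∀ a b c d → c + a ≡ d + b → a - b ≡ d - c
        transpose a b c d e = trans (l a b c) (trans (cong (λ z → z - b - c) e) (l′ b c d))
          where
          l : ∀ a b c → a - b ≡ (c + a) - b - c
          l = solve-∀
          l′ : ∀ b c d → (d + b) - b - c ≡ d - c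
          l′ = solve-∀
        telescope : ∀ a b t → (a - b) + (b - t) ≡ a - t
        telescope = solve-∀
        [X-]-D : ∀ i → ([X- t ]* D) i ≡ ([X- t ]* Q) i - ([X- t ]* q) i
        [X-]-D zero = l t (Q 0) (q 0)
          where
          l : ∀ t u v → - (t * (u - v)) ≡ - (t * u) - - (t * v)
          l = solve-∀
        [X-]-D (suc i) = l t (Q i) (q i) (Q (suc i)) (q (suc i))
          where
          l : ∀ t u v u′ v′ → (u - v) - t * (u′ - v′) ≡ (u - t * u′) - (v - t * v′)
          l = solve-∀
        diff : ∀ i → ([X- t ]* D) i ≡ r i - constant c i
        diff i = trans ([X-]-D i) (transpose _ _ (constant c i) (r i)
          (trans (sym (quotient-step k t [] i)) (trans (eq i) (cong (_+_ (r i)) (e i)))))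
        r₀-tᵖ : r 0 - t ^ p ≡ ([X- t ]* D) 0
        r₀-tᵖ = trans (cong (λ z → r 0 - z) (sym (h-singleton p t))) (sym (diff 0))
        D0 : SupportBelow 0 D
        D0 = Support-[X-]⁻¹ t {n ℕ.⊔ p}
          (λ i n≤i → ∣m∣n⇒∣m-n (Support-quotient k (t ∷ []) i (ℕ.≤-trans (ℕ.m≤n⊔m n p) n≤i))
                               (S i (ℕ.≤-trans (ℕ.m≤m⊔n n p) n≤i)))
          (λ i 1≤i → subst (+ p ∣_) (sym (diff i))
            (∣m∣n⇒∣m-n (R i 1≤i) (Support-constant c i 1≤i)))

    -- Modulo p, the remainder r of X^p has degree at most |T′|. Differentiation shows that it is
    -- constant, and a constant remainder is congruent to every node.
    repeatEach-congruent : ∀ m L → length (repeatEach (suc m) L) ℕ.< p →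
      suc (length (repeatEach m L)) ℕ.≤ p →
      TopVanishing (suc (length (repeatEach m L))) (repeatEach (suc m) L) →
      ∃ λ c → ∀ {t} → t ∈ repeatEach (suc m) L → c ≈ t
    repeatEach-congruent m L T<p s≤p V = r 0 , λ t∈T → root-of-Xᵖ-const R1 (∣ᵖ-member t∈T T∣) eq
      where
      T  = repeatEach (suc m) L
      T′ = repeatEach m L
      n  = p ℕ.∸ length T
      Q  = quotient n T
      N  = newton (suc (length T′)) T n (ℕ.m∸n+n≡m (ℕ.<⇒≤ T<p)) V
      r  = proj₁ N
      R  = proj₁ (proj₂ N)
      eq = proj₂ (proj₂ N)
      T∣ : T ∣ᵖ ∏[X- T ]* Q
      T∣ = factor Q (suc n) (Support-quotient n T) (λ _ → refl)
      ∂eq : ∀ i → ∂ (quotient p []) i ≡ ∂ r i + ∂ (∏[X- T ]* Q) i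
      ∂eq i = trans (cong (_*_ (+ suc i)) (eq (suc i))) (ℤ.*-distribˡ-+ (+ suc i) (r (suc i)) ((∏[X- T ]* Q) (suc i)))
      cancelˡ : ∀ a b → (a + b) - a ≡ b
      cancelˡ = solve-∀
      cancelʳ : ∀ a b → (a + b) - b ≡ a
      cancelʳ = solve-∀
      ∂R : SupportBelow (length T′) (∂ r)
      ∂R i T′≤i = ∣n⇒∣m*n (+ suc i) (R (suc i) (s≤s T′≤i))
      ∂T-support : SupportBelow 0 (∂ (∏[X- T ]* Q))
      ∂T-support with ∣ᵖ-∂-repeatEach m L T∣
      -- Modulo p this derivative is -r′, of degree below |T′|, yet a multiple of ∏ (X - t), t ∈ T′;
      -- so its cofactor vanishes.
      ... | factor q b S e = Support-resp (λ i → sym (e i)) (Support0-∏ T′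
        (Support-∏⁻¹ T′ S λ i T′≤i → subst (+ p ∣_) (trans (cong (_- ∂ r i) (∂eq i))
            (trans (cancelˡ (∂ r i) _) (e i)))
          (∣m∣n⇒∣m-n (p∣∂Xᵖ i z≤n) (∂R i (subst (ℕ._≤ i) (ℕ.+-identityʳ _) T′≤i)))))
      R1 : SupportBelow 1 r
      -- Beyond degree |T′| the bound on r applies; up to it, i + 1 ≤ |T′| < p can be cancelled from
      -- r′ ≡ 0.
      R1 (suc i) _ with suc (length T′) ℕ.≤? suc i
      ... | yes T′<i = R (suc i) T′<i
      ... | no  T′≮i = euclid (+ suc i) (r (suc i))
        (subst (+ p ∣_) (trans (cong (_- ∂ (∏[X- T ]* Q) i) (∂eq i)) (cancelʳ (∂ r i) _))
          (∣m∣n⇒∣m-n (p∣∂Xᵖ i z≤n) (∂T-support i z≤n)))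
        (p∤suc i (ℕ.<-≤-trans (ℕ.≰⇒> T′≮i) s≤p))

    -- Intercepts and undetermined directions

    ι-distinct : ∀ {i j : Fin p} → i ≢ j → ¬ ι i ≈ ι j
    ι-distinct {i} {j} i≢j i≈j = go ∣ ι i - ι j ∣ refl
      where
      bound : ∣ ι i - ι j ∣ ℕ.< p
      bound = ℕ.≤-<-trans
        (subst (ℕ._≤ Fin.toℕ i ℕ.⊔ Fin.toℕ j) (cong ∣_∣ (sym (ℤ.m-n≡m⊖n (Fin.toℕ i) (Fin.toℕ j))))
          (ℤ.∣m⊝n∣≤m⊔n (Fin.toℕ i) (Fin.toℕ j)))
        (ℕ.⊔-lub (Fin.toℕ<n i) (Fin.toℕ<n j))
      go : ∀ k → ∣ ι i - ι j ∣ ≡ k → ⊥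
      go zero    eq = i≢j (Fin.toℕ-injective (ℤ.+-injective (ℤ.i-j≡0⇒i≡j (ι i) (ι j) (ℤ.∣i∣≡0⇒i≡0 eq))))
      go (suc k) eq = ℕ.<⇒≱ (subst (ℕ._< p) eq bound) (ℕ.∣⇒≤ (subst (p ℕ.∣_) eq (∣⇒∣ᵤ i≈j)))

    -ι-distinct : ∀ {i j : Fin p} → i ≢ j → ¬ - ι i ≈ - ι j
    -ι-distinct {i} {j} i≢j -i≈-j =
      ι-distinct i≢j (subst (+ p ∣_) (lemma (ι i) (ι j)) (∣m⇒∣-m -i≈-j))
      where
      lemma : ∀ x y → - (- x - - y) ≡ x - y
      lemma = solve-∀

    -- The line of slope y through (a , b) is identified by its intercept b - a y.
    intercept : ℤ → Point p → ℤ
    intercept y (a , b) = ι b - ι a * y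

    intercept-0 : ∀ a b → intercept 0ℤ (a , b) ≡ ι b
    intercept-0 a b = lemma (ι a) (ι b)
      where
      lemma : ∀ x y → y - x * 0ℤ ≡ y
      lemma = solve-∀

    -- In the recursion of `h` the head contributes a factor b - a y, whose coefficient of y is -a;
    -- so the top coefficients follow the same recursion at the nodes -a.
    h-intercepts-Deg≤ : ∀ m U →
      Deg≤ m (λ y → h m (map (intercept y) U)) (h m (map (λ (a , _) → - ι a) U))
    h-intercepts-Deg≤ zero    U             = λ _ → refl
    h-intercepts-Deg≤ (suc m) []            = Deg≤-const m 0ℤ
    h-intercepts-Deg≤ (suc m) ((a , b) ∷ U) = Deg≤-+ (suc m) (h-intercepts-Deg≤ (suc m) U)
      (Deg≤-linear-* m (ι a) (ι b) (h-intercepts-Deg≤ m ((a , b) ∷ U)))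

    intercepts-distinct : ∀ {S : Point p → Set} {d} → ¬ Determines S (just d) →
      ∀ {U} → Unique U → All S U → Distinct (map (intercept (ι d)) U)
    intercepts-distinct {S} {d} ¬det uU SU = AllPairs.map⁺ (go uU SU)
      where
      lemma : ∀ a₁ b₁ a₂ b₂ d → (b₁ - a₁ * d) - (b₂ - a₂ * d) ≡ (b₁ - b₂) - d * (a₁ - a₂)
      lemma = solve-∀
      separate : ∀ {u v} → S u → u ≢ v × S v → ¬ intercept (ι d) u ≈ intercept (ι d) v
      separate {a₁ , b₁} {a₂ , b₂} Su (u≢v , Sv) u≈v = ¬det (_ , _ , Su , Sv , u≢v ,
        ∣⇒∣ᵤ (subst (+ p ∣_) (lemma (ι a₁) (ι b₁) (ι a₂) (ι b₂) (ι d)) u≈v))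
      go : ∀ {U} → Unique U → All S U →
        AllPairs (λ u v → ¬ intercept (ι d) u ≈ intercept (ι d) v) U
      go []         []        = []
      go (u≢U ∷ uU) (Su ∷ SU) = All.map (separate Su) (All.zip (u≢U , SU)) ∷ go uU SU

    module _ {S : Point p → Set} {R : List (Fin p)} (uR : Unique R)
             (R-undetermined : All (λ d → ¬ Determines S (just d)) R) where

      -- Every undetermined slope is a root, by `h-distinct≈0`, of a polynomial in y of degree at
      -- most m, and there are more than m of them. Its value at 0 involves the ordinates, its top
      -- coefficient the negated abscissas.
      h-points : ∀ m u v w U → m ℕ.+ (2 ℕ.+ length U) ≡ p → m ℕ.< length R →
        let U₊ = u ∷ v ∷ w ∷ U in Unique U₊ → All S U₊ →
        (+ p ∣ h m (map (intercept 0ℤ) U₊)) × (+ p ∣ h m (map (λ (a , _) → - ι a) U₊))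
      h-points m u v w U eq m<R uU SU = proj₁ vanish 0ℤ , proj₂ vanish
        where
        U₊ = u ∷ v ∷ w ∷ U
        vanish = Deg≤-roots m (map ι R) (subst (m ℕ.<_) (sym (length-map ι R)) m<R)
          (h-intercepts-Deg≤ m U₊)
          (AllPairs.map⁺ (AllPairs.map ι-distinct uR))
          (All.map⁺ (All.map (λ {d} ¬det →
            h-distinct≈0 m _ _ _ (map (intercept (ι d)) U)
              (trans (cong (λ k → m ℕ.+ (2 ℕ.+ k)) (length-map (intercept (ι d)) U)) eq)
              (intercepts-distinct ¬det uU SU)) R-undetermined))

      topVanishing : ∀ s → 2 ℕ.≤ s → p ℕ.< length R ℕ.+ s → ∀ U → Unique U → All S U →
        TopVanishing s (map (intercept 0ℤ) U) × TopVanishing s (map (λ (a , _) → - ι a) U)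
      topVanishing s 2≤s p<R+s []      uU SU = tt , tt
      topVanishing s 2≤s p<R+s (u ∷ U) (u≢U ∷ uU) (Su ∷ SU)
        with topVanishing s 2≤s p<R+s U uU SU
      ... | V₁ , V₂ =
        ((λ n eq s≤ → proj₁ (both n (length-map _ U) eq s≤)) , V₁) ,
        ((λ n eq s≤ → proj₂ (both n (length-map _ U) eq s≤)) , V₂)
        where
        both : ∀ n {k} → k ≡ length U → n ℕ.+ k ≡ p → s ℕ.≤ k →
          (+ p ∣ h n (map (intercept 0ℤ) (u ∷ U))) × (+ p ∣ h n (map (λ (a , _) → - ι a) (u ∷ U)))
        both n refl eq s≤U = go U (ℕ.≤-trans 2≤s s≤U) eq (u≢U ∷ uU) (Su ∷ SU)
          where
          n<R : n ℕ.< length R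
          -- n + s ≤ n + |U| = p < |R| + s.
          n<R = ℕ.+-cancelʳ-< s n (length R)
            (ℕ.≤-<-trans (subst (n ℕ.+ s ℕ.≤_) eq (ℕ.+-monoʳ-≤ n s≤U)) p<R+s)
          -- From 2 ≤ s ≤ |U| there are at least three nodes; at two distinct ones the coefficient
          -- is 1 by `h-pair≈1`.
          go : ∀ U → 2 ℕ.≤ length U → n ℕ.+ length U ≡ p → Unique (u ∷ U) → All S (u ∷ U) →
            (+ p ∣ h n (map (intercept 0ℤ) (u ∷ U))) × (+ p ∣ h n (map (λ (a , _) → - ι a) (u ∷ U)))
          go (v ∷ [])    (s≤s ())
          go (v ∷ w ∷ U) _ eq = h-points n u v w U eq n<R

    -- Product sets

    distinct⇒¬congruent : ∀ {c L} → 2 ℕ.≤ length L → Distinct L → ¬ (∀ {t} → t ∈ L → c ≈ t)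
    distinct⇒¬congruent {L = _ ∷ []} (s≤s ())
    distinct⇒¬congruent {c} {x ∷ y ∷ L} _ ((x≉y ∷ _) ∷ _) c≈L =
      x≉y (subst (+ p ∣_) (lemma c x y) (∣m∣n⇒∣m-n (c≈L (there (here refl))) (c≈L (here refl))))
      where
      lemma : ∀ c x y → (c - y) - (c - x) ≡ x - y
      lemma = solve-∀

    -- The values of `ψ` are nodes of multiplicity m + 1, so `repeatEach-congruent` would make them
    -- all congruent. Abstracting `φ` and `ψ` serves ordinates and negated abscissas alike.
    topVanishing-product⇒⊥ : ∀ (f : Fin p → Fin p → Point p) (φ : Point p → ℤ) (ψ : Fin p → ℤ) →
      (∀ x y → φ (f x y) ≡ ψ x) → (∀ {i j} → i ≢ j → ¬ ψ i ≈ ψ j) →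
      ∀ xs ys m → Unique xs → length ys ≡ suc m → 2 ℕ.≤ length xs → length xs ℕ.* suc m ℕ.< p →
      ¬ TopVanishing (suc (length xs ℕ.* m)) (map φ (cartesianProductWith f xs ys))
    topVanishing-product⇒⊥ f φ ψ φf≡ψ ψ-distinct xs ys m uxs |ys|≡ 2≤xs xy<p V =
      distinct⇒¬congruent {proj₁ congruent} (subst (2 ℕ.≤_) (sym (length-map ψ xs)) 2≤xs)
        (AllPairs.map⁺ (AllPairs.map ψ-distinct uxs))
        (λ t∈L → proj₂ congruent (∈-repeatEach m t∈L))
      where
      L = map ψ xs
      length-L : ∀ k → length (repeatEach k L) ≡ length xs ℕ.* k
      length-L k = trans (length-repeatEach k L) (cong (ℕ._* k) (length-map ψ xs))
      congruent = repeatEach-congruent m L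
        (subst (ℕ._< p) (sym (length-L (suc m))) xy<p)
        (subst (ℕ._< p) (sym (length-L m))
          (ℕ.≤-<-trans (ℕ.*-monoʳ-≤ (length xs) (ℕ.n≤1+n m)) xy<p))
        (subst₂ TopVanishing (cong suc (sym (length-L m)))
          (trans (map-cartesianProductWith f φ ψ φf≡ψ xs ys) (cong (λ k → repeatEach k L) |ys|≡)) V)

    -- Counting determined directions

    module _ (A B : Subset p) where

      determines? : ∀ d → Dec (Determines (A ⊠ B) (just d))
      determines? d = Dec.map′
        (λ (a₁ , b₁ , a₂ , b₂ , w) → (a₁ , b₁) , (a₂ , b₂) , w)
        (λ ((a₁ , b₁) , (a₂ , b₂) , w) → a₁ , b₁ , a₂ , b₂ , w)
        (Fin.any? λ a₁ → Fin.any? λ b₁ → Fin.any? λ a₂ → Fin.any? λ b₂ →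
          (a₁ ∈? A ×-dec b₁ ∈? B) ×-dec (a₂ ∈? A ×-dec b₂ ∈? B) ×-dec
          ¬? (≡-dec Fin._≟_ Fin._≟_ (a₁ , b₁) (a₂ , b₂)) ×-dec
          (p ℕ.∣? ∣ (ι b₁ - ι b₂) - ι d * (ι a₁ - ι a₂) ∣))

      determined undetermined : List (Fin p)
      determined   = filter determines? (allFin p)
      undetermined = filter (¬? ∘ determines?) (allFin p)

      determined+undetermined : length determined ℕ.+ length undetermined ≡ p
      determined+undetermined = trans (length-filter-¬ determines? (allFin p)) (length-tabulate (λ i → i))

      -- At least p - e slopes are undetermined, which is more than p - s for s = e + 1.
      few-directions⇒topVanishing : ∀ e → 1 ℕ.≤ e → length determined ℕ.≤ e → ∀ U → Unique U →
        All (A ⊠ B) U →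
        TopVanishing (suc e) (map (intercept 0ℤ) U) × TopVanishing (suc e) (map (λ (a , _) → - ι a) U)
      few-directions⇒topVanishing e 1≤e det≤e =
        topVanishing (Unique.filter⁺ (¬? ∘ determines?) (Unique.allFin⁺ p))
          (All.all-filter (¬? ∘ determines?) (allFin p)) (suc e) (s≤s 1≤e)
          (subst₂ ℕ._<_ (trans (ℕ.+-comm (length undetermined) _) determined+undetermined) refl
            (ℕ.+-monoʳ-< (length undetermined) (s≤s det≤e)))

      manyDirections-B : ∀ m → ∣ A ∣ₛ ≡ suc m → 2 ℕ.≤ ∣ A ∣ₛ → 2 ℕ.≤ ∣ B ∣ₛ → ∣ A ∣ₛ ℕ.* ∣ B ∣ₛ ℕ.< p →
        ∣ B ∣ₛ ℕ.* m ℕ.< length determined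
      manyDirections-B m |A|≡ 2≤A 2≤B AB<p = ℕ.≰⇒> λ det≤ →
        -- Listing by ordinate first puts the |A| points with equal b side by side, as `repeatEach`
        -- does.
        topVanishing-product⇒⊥ (λ b a → a , b) (intercept 0ℤ) ι (λ b a → intercept-0 a b) ι-distinct
          (elements B) (elements A) m (elements-unique B) (trans (length-elements A) |A|≡)
          (subst (2 ℕ.≤_) (sym (length-elements B)) 2≤B)
          (subst (ℕ._< p) (trans (ℕ.*-comm ∣ A ∣ₛ _) (cong₂ ℕ._*_ (sym (length-elements B)) |A|≡)) AB<p)
          (proj₁ (few-directions⇒topVanishing _
            (subst (λ k → 1 ℕ.≤ k ℕ.* m) (sym (length-elements B))
              (1≤*pred 2≤B (subst (2 ℕ.≤_) |A|≡ 2≤A)))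
            (subst (λ k → length determined ℕ.≤ k ℕ.* m) (sym (length-elements B)) det≤) _
              (Unique.cartesianProductWith⁺ _ (λ { refl → refl , refl })
                (elements-unique B) (elements-unique A))
              (All.cartesianProductWith⁺ (setoid _) (setoid _) _ (elements B) (elements A)
                λ b∈ a∈ → elements-sound A a∈ , elements-sound B b∈)))

      -- The top coefficient in y is used here: each node -a has multiplicity |B|, which gives the
      -- bound |A||B| - |A|.
      manyDirections-A : ∀ m → ∣ B ∣ₛ ≡ suc m → 2 ℕ.≤ ∣ A ∣ₛ → 2 ℕ.≤ ∣ B ∣ₛ → ∣ A ∣ₛ ℕ.* ∣ B ∣ₛ ℕ.< p →
        ∣ A ∣ₛ ℕ.* m ℕ.< length determined
      manyDirections-A m |B|≡ 2≤A 2≤B AB<p = ℕ.≰⇒> λ det≤ →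
        topVanishing-product⇒⊥ _,_ (λ (a , _) → - ι a) (λ a → - ι a) (λ _ _ → refl) -ι-distinct
          (elements A) (elements B) m (elements-unique A) (trans (length-elements B) |B|≡)
          (subst (2 ℕ.≤_) (sym (length-elements A)) 2≤A)
          (subst (ℕ._< p) (cong₂ ℕ._*_ (sym (length-elements A)) |B|≡) AB<p)
          (proj₂ (few-directions⇒topVanishing _
            (subst (λ k → 1 ℕ.≤ k ℕ.* m) (sym (length-elements A))
              (1≤*pred 2≤A (subst (2 ℕ.≤_) |B|≡ 2≤B)))
            (subst (λ k → length determined ℕ.≤ k ℕ.* m) (sym (length-elements A)) det≤) _
              (Unique.cartesianProductWith⁺ _ (λ { refl → refl , refl })
                (elements-unique A) (elements-unique B))
              (All.cartesianProductWith⁺ (setoid _) (setoid _) _ (elements A) (elements B)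
                λ a∈ b∈ → elements-sound A a∈ , elements-sound B b∈)))

      ∞-determined : 2 ℕ.≤ ∣ A ∣ₛ → 2 ℕ.≤ ∣ B ∣ₛ → Determines (A ⊠ B) nothing
      ∞-determined 2≤A 2≤B = go (elements A) (elements B) (elements-sound A) (elements-sound B)
        (elements-unique B) (subst (2 ℕ.≤_) (sym (length-elements A)) 2≤A)
        (subst (2 ℕ.≤_) (sym (length-elements B)) 2≤B)
        where
        go : ∀ as bs → (∀ {a} → a ∈ as → a ∈ₛ A) → (∀ {b} → b ∈ bs → b ∈ₛ B) → Unique bs →
          2 ℕ.≤ length as → 2 ℕ.≤ length bs → Determines (A ⊠ B) nothing
        go _        (_ ∷ [])     _  _  _                 _ (s≤s ())
        go (a ∷ as) (b ∷ c ∷ bs) SA SB ((b≢c ∷ _) ∷ _) _ _ =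
          (a , b) , (a , c) , (SA (here refl) , SB (here refl)) ,
          (SA (here refl) , SB (there (here refl))) , (λ eq → b≢c (cong proj₂ eq)) , refl

      determined-bound : 2 ℕ.≤ ∣ A ∣ₛ → 2 ℕ.≤ ∣ B ∣ₛ → ∣ A ∣ₛ ℕ.* ∣ B ∣ₛ ℕ.< p →
        ∣ A ∣ₛ ℕ.* ∣ B ∣ₛ ℕ.∸ (∣ A ∣ₛ ℕ.⊓ ∣ B ∣ₛ) ℕ.< length determined
      determined-bound 2≤A 2≤B AB<p with ∣ A ∣ₛ in |A|≡ | ∣ B ∣ₛ in |B|≡
      ... | suc a | suc b with ℕ.≤-total (suc a) (suc b)
      -- The better bound subtracts the smaller cardinality: |A||B| - |A| = |A| b.
      ...   | inj₁ A≤B = subst (ℕ._< length determined)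
        (sym (trans (cong₂ ℕ._∸_ (ℕ.*-suc (suc a) b) (ℕ.m≤n⇒m⊓n≡m A≤B)) (ℕ.m+n∸m≡n (suc a) _)))
        (subst (λ k → k ℕ.* b ℕ.< length determined) |A|≡ (manyDirections-A b |B|≡
          (subst (2 ℕ.≤_) (sym |A|≡) 2≤A) (subst (2 ℕ.≤_) (sym |B|≡) 2≤B)
          (subst₂ (λ k l → k ℕ.* l ℕ.< p) (sym |A|≡) (sym |B|≡) AB<p)))
      ...   | inj₂ B≤A = subst (ℕ._< length determined)
        (sym (trans (cong₂ ℕ._∸_ (trans (ℕ.*-comm (suc a) (suc b)) (ℕ.*-suc (suc b) a))
                                 (ℕ.m≥n⇒m⊓n≡n B≤A)) (ℕ.m+n∸m≡n (suc b) _)))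
        (subst (λ k → k ℕ.* a ℕ.< length determined) |B|≡ (manyDirections-B a |A|≡
          (subst (2 ℕ.≤_) (sym |A|≡) 2≤A) (subst (2 ℕ.≤_) (sym |B|≡) 2≤B)
          (subst₂ (λ k l → k ℕ.* l ℕ.< p) (sym |A|≡) (sym |B|≡) AB<p)))

open import Data.Nat using (_+_; _*_; _∸_; _⊓_; _≤_; _<_)
open import Data.Fin.Subset using (∣_∣)

theorem1 : (p : ℕ) → Prime p → (A B : Subset p) →
    2 ≤ ∣ A ∣ → 2 ≤ ∣ B ∣ → ∣ A ∣ * ∣ B ∣ < p →
    Σ (List (Direction p)) λ ds →
    Unique ds × All (Determines (A ⊠ B)) ds ×
    (∣ A ∣ * ∣ B ∣ ∸ (∣ A ∣ ⊓ ∣ B ∣) + 2 ≤ length ds)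
theorem1 p pr A B 2≤A 2≤B AB<p = nothing ∷ map just slopes ,
  All.map⁺ (All.universal (λ _ ()) slopes)
    ∷ Unique.map⁺ just-injective (Unique.filter⁺ (determines? A B) (Unique.allFin⁺ p)) ,
  ∞-determined A B 2≤A 2≤B ∷ All.map⁺ (All.all-filter (determines? A B) (allFin p)) ,
  -- Of the summand 2, one unit is ∞ and the other the strictness of `determined-bound`.
  subst₂ _≤_ (ℕ.+-comm 2 _) (cong suc (sym (length-map just slopes)))
    (s≤s (determined-bound A B 2≤A 2≤B AB<p))
  where
  open Modulo pr
  slopes = determined A B
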